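{- We have $$(-y;q)_\infty=\sum_{n_1,n_2,n_3\ge 0}\frac{(-1)^{n_1}x^{n_1+n_2}y^{n_3}\,q^{3\binom{n_1}{2}+\binom{n_2}{2}+\binom{n_3}{2}+n_1n_2+n_2n_3+n_3n_1}\,(-q;q)_{n_1+n_2+n_3}}{(q^2;q^2)_{n_1}(q^2;q^2)_{n_2}(q^2;q^2)_{n_3}}.$$
   Context: The $q$-Pochhammer symbol is $(A;q)_n:=\prod_{k=0}^{n-1}(1-Aq^k)$ for $n\in\mathbb{N}\cup\{\infty\}$. Here $x,y,q$ are indeterminates, and the identity is between formal power series in $x$ and $y$ whose coefficients are formal power series in $q$. -}

module Defs where

open import Algebra.Bundles using (RawRing; CommutativeRing)
import Algebra.Definitions.RawSemiring as RawSemiringDefs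
import Algebra.Properties.Monoid.Sum as MonoidSum
import Relation.Binary.Reasoning.Setoid as SetoidReasoning
import Relation.Binary.PropositionalEquality as ≡
open import Data.Nat.Base as ℕ using (ℕ; zero; suc; _∸_; _≤_)
open import Data.Nat.Combinatorics using (_C_)
open import Data.Fin.Base using (Fin; zero; suc; toℕ)
open import Data.Product.Base using (∃; _×_; _,_)
open import Data.Sum.Base using (_⊎_)

------------------------------------------------------------------------
-- Formal power series in one variable, f standing for Σₙ f n · Xⁿ

module PowerSeries {c ℓ} (R : RawRing c ℓ) where
  open RawRing R
  open RawSemiringDefs rawSemiring using (sum)

  Series : Set c
  Series = ℕ → Carrier

  const : Carrier → Series
  const a zero    = a
  const a (suc _) = 0#

  X : Series
  X (suc zero) = 1#
  X _          = 0#

  _⊛_ : Series → Series → Series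
  (f ⊛ g) n = sum {suc n} λ i → f (toℕ i) * g (n ∸ toℕ i)

  rawRing : RawRing c ℓ
  rawRing = record
    { Carrier = Series
    ; _≈_     = λ f g → ∀ n → f n ≈ g n
    ; _+_     = λ f g n → f n + g n
    ; _*_     = _⊛_
    ; -_      = λ f n → - f n
    ; 0#      = λ _ → 0#
    ; 1#      = const 1#
    }

  -- The reciprocal g of a series f with f 0 = 1, from comparing the
  -- coefficients of f g = 1:  g n = [n = 0] − Σ_{i<n} f (i+1) g (n−1−i).
  -- It is only meaningful when f 0 = 1 (see recip-inverse below).
  -- recipPrefix f n lists g (n−1), …, g 0.

  recipPrefix : Series → ∀ n → Fin n → Carrier
  recipPrefix f (suc n) zero    =
    const 1# n + - sum {n} λ i → f (suc (toℕ i)) * recipPrefix f n i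
  recipPrefix f (suc n) (suc i) = recipPrefix f n i

  recip : Series → Series
  recip f n = recipPrefix f (suc n) zero

  infixl 7 _÷_
  _÷_ : Series → Series → Series
  f ÷ g = f ⊛ recip g

------------------------------------------------------------------------
-- Finite q-Pochhammer symbols (A;q)ₙ

module Pochhammer {c ℓ} (R : RawRing c ℓ) where
  open RawRing R
  open RawSemiringDefs rawSemiring using (product; _^_)

  ⟨_⨾_⟩_ : Carrier → Carrier → ℕ → Carrier
  ⟨ A ⨾ q ⟩ n = product {n} λ k → 1# + - (A * q ^ toℕ k)

------------------------------------------------------------------------
-- Formal power series in x and y over K = R⟦q⟧, for a ring R of scalars

module Identity {c ℓ} (R : CommutativeRing c ℓ) where
  open CommutativeRing R using (_≈_; 0#) renaming (rawRing to R₀)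

  module R⟦q⟧ = PowerSeries R₀

  K : RawRing c ℓ
  K = R⟦q⟧.rawRing

  module K⟦y⟧ = PowerSeries K
  module K⟦x,y⟧ = PowerSeries K⟦y⟧.rawRing

  -- For F in S, the coefficient of xᵃ yᵇ qᵈ is F a b d.
  S : RawRing c ℓ
  S = K⟦x,y⟧.rawRing

  open RawRing S public using (-_) renaming (Carrier to ∣S∣)

  ι : RawRing.Carrier K → ∣S∣
  ι k = K⟦x,y⟧.const (K⟦y⟧.const k)

  x y q : ∣S∣
  x = K⟦x,y⟧.X
  y = K⟦x,y⟧.const K⟦y⟧.X
  q = ι R⟦q⟧.X

  -- Limits are taken coefficientwise, with R discrete: every coefficient
  -- is eventually constant.  Limits, and likewise the sums below, are unique,
  -- so a common value P expresses an equality of the two sides.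
  _⟶_ : (ℕ → ∣S∣) → ∣S∣ → Set ℓ
  s ⟶ L = ∀ a b d → ∃ λ N → ∀ n → N ≤ n → s n a b d ≈ L a b d

  Is⟨_⨾_⟩∞ : ∣S∣ → ∣S∣ → ∣S∣ → Set ℓ
  Is⟨ A ⨾ p ⟩∞ L = (λ n → Pochhammer.⟨_⨾_⟩_ S A p n) ⟶ L

  sumS : ℕ → (ℕ → ∣S∣) → ∣S∣
  sumS n t = RawSemiringDefs.sum (RawRing.rawSemiring S) {n} λ i → t (toℕ i)

  -- L = Σ_{n₁,n₂,n₃≥0} t n₁ n₂ n₃ as a formal sum: each coefficient is
  -- non-zero in only finitely many terms, namely inside a box [0,N)³, and
  -- these terms add up to the coefficient of L.
  HasSum : (ℕ → ℕ → ℕ → ∣S∣) → ∣S∣ → Set ℓ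
  HasSum t L = ∀ a b d → ∃ λ N →
      (∀ n₁ n₂ n₃ → N ≤ n₁ ⊎ N ≤ n₂ ⊎ N ≤ n₃ → t n₁ n₂ n₃ a b d ≈ 0#)
    × sumS N (λ n₁ → sumS N λ n₂ → sumS N λ n₃ → t n₁ n₂ n₃) a b d ≈ L a b d

  exponent : ℕ → ℕ → ℕ → ℕ
  exponent n₁ n₂ n₃ =
    3 ℕ.* (n₁ C 2) ℕ.+ (n₂ C 2) ℕ.+ (n₃ C 2)
    ℕ.+ n₁ ℕ.* n₂ ℕ.+ n₂ ℕ.* n₃ ℕ.+ n₃ ℕ.* n₁

  module _ where
    open RawRing K using (_*_; 1#) renaming (-_ to neg_)
    open RawSemiringDefs (RawRing.rawSemiring K) using (_^_)
    open Pochhammer K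

    𝐪 : RawRing.Carrier K
    𝐪 = R⟦q⟧.X

    numerator denominator : ℕ → ℕ → ℕ → RawRing.Carrier K
    numerator n₁ n₂ n₃ =
      (neg 1#) ^ n₁ * 𝐪 ^ exponent n₁ n₂ n₃ * ⟨ neg 𝐪 ⨾ 𝐪 ⟩ (n₁ ℕ.+ n₂ ℕ.+ n₃)
    denominator n₁ n₂ n₃ =
      ⟨ 𝐪 ^ 2 ⨾ 𝐪 ^ 2 ⟩ n₁ * ⟨ 𝐪 ^ 2 ⨾ 𝐪 ^ 2 ⟩ n₂ * ⟨ 𝐪 ^ 2 ⨾ 𝐪 ^ 2 ⟩ n₃

  -- The denominator is invertible by denominator-0 and recip-inverse below.
  coefficient : ℕ → ℕ → ℕ → RawRing.Carrier K
  coefficient n₁ n₂ n₃ = numerator n₁ n₂ n₃ R⟦q⟧.÷ denominator n₁ n₂ n₃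

  summand : ℕ → ℕ → ℕ → ∣S∣
  summand n₁ n₂ n₃ = ι (coefficient n₁ n₂ n₃) * x ^ (n₁ ℕ.+ n₂) * y ^ n₃
    where
    open RawRing S using (_*_)
    open RawSemiringDefs (RawRing.rawSemiring S) using (_^_)

------------------------------------------------------------------------
-- The reciprocals above are genuine

module _ {c ℓ} (R : CommutativeRing c ℓ) where
  open CommutativeRing R hiding (zero)
  open PowerSeries rawRing hiding (rawRing)
  open RawRing (PowerSeries.rawRing rawRing)
    using () renaming (_≈_ to _≋_; 1# to 𝟙)
  open MonoidSum +-monoid using (sum; sum-cong-≋)
  open SetoidReasoning setoid

  recipPrefix-recip : ∀ f n (i : Fin n) →
                      recipPrefix f n i ≡.≡ recip f (n ∸ suc (toℕ i))
  recipPrefix-recip f (suc n) zero    = ≡.refl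
  recipPrefix-recip f (suc n) (suc i) = recipPrefix-recip f n i

  recip-inverse : ∀ f → f 0 ≈ 1# → (f ⊛ recip f) ≋ 𝟙
  recip-inverse f f₀≈1 n = begin
    f 0 * recip f n + tail n         ≈⟨ +-congʳ (*-congʳ f₀≈1) ⟩
    1# * recip f n + tail n          ≈⟨ +-congʳ (*-identityˡ _) ⟩
    (𝟙 n + - tail′ n) + tail n       ≈⟨ +-congˡ (tail≈ n) ⟩
    (𝟙 n + - tail′ n) + tail′ n      ≈⟨ +-assoc _ _ _ ⟩
    𝟙 n + (- tail′ n + tail′ n)      ≈⟨ +-congˡ (-‿inverseˡ _) ⟩
    𝟙 n + 0#                         ≈⟨ +-identityʳ _ ⟩
    𝟙 n                              ∎
    where
    tail tail′ : ℕ → Carrier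
    tail  n = sum {n} λ i → f (suc (toℕ i)) * recip f (n ∸ suc (toℕ i))
    tail′ n = sum {n} λ i → f (suc (toℕ i)) * recipPrefix f n i
    tail≈ : ∀ n → tail n ≈ tail′ n
    tail≈ n = sum-cong-≋ λ i →
      *-congˡ (reflexive (≡.sym (recipPrefix-recip f n i)))

module _ {c ℓ} (R : CommutativeRing c ℓ) where
  open CommutativeRing R hiding (zero)
  open Identity R using (K; 𝐪; denominator)
  open RawRing K using () renaming (_*_ to _⊛_)
  open RawSemiringDefs (RawRing.rawSemiring K) using (product; _^_)
  open Pochhammer K
  open SetoidReasoning setoid
  open import Algebra.Properties.Ring ring using (-0#≈0#)

  private
    ⊛-0 : ∀ f g → (f ⊛ g) 0 ≈ f 0 * g 0
    ⊛-0 f g = +-identityʳ _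

    ⊛-0-1 : ∀ f g → f 0 ≈ 1# → g 0 ≈ 1# → (f ⊛ g) 0 ≈ 1#
    ⊛-0-1 f g p r = trans (⊛-0 f g) (trans (*-cong p r) (*-identityˡ _))

    factor-0 : ∀ A g → A 0 ≈ 0# → 1# + - (A ⊛ g) 0 ≈ 1#
    factor-0 A g p = begin
      1# + - (A ⊛ g) 0    ≈⟨ +-congˡ (-‿cong (⊛-0 A g)) ⟩
      1# + - (A 0 * g 0)  ≈⟨ +-congˡ (-‿cong (*-congʳ p)) ⟩
      1# + - (0# * g 0)   ≈⟨ +-congˡ (-‿cong (zeroˡ _)) ⟩
      1# + - 0#           ≈⟨ +-congˡ -0#≈0# ⟩
      1# + 0#             ≈⟨ +-identityʳ _ ⟩
      1#                  ∎

    product-0 : ∀ n (t : Fin n → RawRing.Carrier K) → (∀ k → t k 0 ≈ 1#) →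
                product t 0 ≈ 1#
    product-0 zero    t p = refl
    product-0 (suc n) t p =
      ⊛-0-1 (t zero) (product t′) (p zero) (product-0 n t′ λ k → p (suc k))
      where t′ = λ k → t (suc k)

    d : ℕ → RawRing.Carrier K
    d n = ⟨ 𝐪 ^ 2 ⨾ 𝐪 ^ 2 ⟩ n

    d-0 : ∀ n → d n 0 ≈ 1#
    d-0 n = product-0 n _ λ k → factor-0 (𝐪 ^ 2) ((𝐪 ^ 2) ^ toℕ k)
      (trans (⊛-0 𝐪 (𝐪 ^ 1)) (zeroˡ _))

  denominator-0 : ∀ n₁ n₂ n₃ → denominator n₁ n₂ n₃ 0 ≈ 1#
  denominator-0 n₁ n₂ n₃ =
    ⊛-0-1 (d n₁ ⊛ d n₂) (d n₃)
      (⊛-0-1 (d n₁) (d n₂) (d-0 n₁) (d-0 n₂)) (d-0 n₃)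

{-# OPTIONS --safe #-}
module Submission where

-- Both sides have coefficient q^(n choose 2) / (q;q)ₙ at yⁿ.  On the left this
-- is Euler's expansion, obtained from (-y;q)∞ = (1 + y) (-qy;q)∞.  On the right,
-- with i + j = m,
--   3 (i choose 2) + (j choose 2) + i j = (m choose 2) + 2 (i choose 2),
-- so the coefficient of xᵐ yⁿ is a prefactor times
--   Σ_{i+j=m} (-1)ⁱ q^(2 (i choose 2)) / ((q²;q²)ᵢ (q²;q²)ⱼ),
-- the coefficient of zᵐ in (z;q²)∞ · 1/(z;q²)∞ = 1.

open import Defs
open import Algebra.Bundles using (RawRing; CommutativeRing)
import Algebra.Definitions.RawSemiring as RawSemiringDefs
import Algebra.Properties.CommutativeSemiring.Exp as Exp
import Algebra.Properties.Ring as RingProperties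
import Algebra.Properties.Semiring.Sum as SemiringSum
import Algebra.Solver.Ring.NaturalCoefficients.Default as Solver
open import Data.Fin.Base using (Fin; toℕ)
open import Data.Fin.Properties using (toℕ<n)
open import Data.Nat.Base as ℕ using (ℕ; zero; suc; _∸_; _≤_; _<_; s≤s)
import Data.Nat.Properties as ℕ
open import Data.Nat.Tactic.RingSolver using (solve-∀)
open import Data.Nat.Combinatorics using (_C_; nC1≡n; nCk+nC[k+1]≡[n+1]C[k+1])
open import Data.Product using (∃; _×_; _,_)
open import Data.Sum.Base using (_⊎_; inj₁; inj₂)
open import Function.Base using (_∘_)
open import Relation.Binary.PropositionalEquality as ≡ using (_≡_)
import Relation.Binary.Reasoning.Setoid as SetoidReasoning

-- Elementary facts about commutative rings.

1-[-x]y≈1+xy : ∀ {c ℓ} (R : CommutativeRing c ℓ) → let open CommutativeRing R in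
  ∀ x y → 1# + - (- x * y) ≈ 1# + x * y
1-[-x]y≈1+xy R x y = +-congˡ (trans (-‿cong (sym (-‿distribˡ-* x y))) (-‿involutive _))
  where
  open CommutativeRing R
  open RingProperties ring using (-‿distribˡ-*; -‿involutive)

inverse-unique : ∀ {c ℓ} (R : CommutativeRing c ℓ) → let open CommutativeRing R in
  ∀ x y z → x * y ≈ 1# → x * z ≈ 1# → y ≈ z
inverse-unique R x y z xy≈1 xz≈1 = begin
  y              ≈⟨ *-identityʳ y ⟨
  y * 1#         ≈⟨ *-congˡ xz≈1 ⟨
  y * (x * z)    ≈⟨ *-assoc y x z ⟨
  y * x * z      ≈⟨ *-congʳ (*-comm y x) ⟩
  x * y * z      ≈⟨ *-congʳ xy≈1 ⟩
  1# * z         ≈⟨ *-identityˡ z ⟩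
  z              ∎
  where
  open CommutativeRing R
  open SetoidReasoning setoid

-- Formal power series: ring structure and coefficients of products.

module SeriesProperties {c ℓ} (R : CommutativeRing c ℓ) where
  open CommutativeRing R hiding (zero)
  open SemiringSum semiring using (sum; sum-cong-≋; ∑-distrib-+; *-distribˡ-sum)
  open PowerSeries rawRing renaming (rawRing to seriesRawRing)
  open RawRing seriesRawRing using () renaming (_≈_ to _≋_; _+_ to _⊕_; 1# to 𝟙)
  open SetoidReasoning setoid

  -- At `suc n` the Cauchy product computes to `f 0 * g (suc n)` plus the product of `f ∘ suc` and
  -- `g` at `n`. This and the following inductions on the degree rest on that unfolding.
  zero-⊛ : ∀ f g → (∀ n → f n ≈ 0#) → ∀ n → (f ⊛ g) n ≈ 0#
  zero-⊛ f g f≈0 zero    = trans (+-identityʳ _) (trans (*-congʳ (f≈0 0)) (zeroˡ _))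
  zero-⊛ f g f≈0 (suc n) = begin
    f 0 * g (suc n) + ((f ∘ suc) ⊛ g) n
      ≈⟨ +-cong (*-congʳ (f≈0 0)) (zero-⊛ (f ∘ suc) g (f≈0 ∘ suc) n) ⟩
    0# * g (suc n) + 0#                  ≈⟨ +-identityʳ _ ⟩
    0# * g (suc n)                       ≈⟨ zeroˡ _ ⟩
    0#                                   ∎

  constant-⊛ : ∀ f g → (∀ n → f (suc n) ≈ 0#) → ∀ n → (f ⊛ g) n ≈ f 0 * g n
  constant-⊛ f g f≈0 zero    = +-identityʳ _
  constant-⊛ f g f≈0 (suc n) = trans (+-congˡ (zero-⊛ (f ∘ suc) g f≈0 n)) (+-identityʳ _)

  linear-⊛ : ∀ f g → (∀ n → f (suc (suc n)) ≈ 0#) →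
             ∀ n → (f ⊛ g) (suc n) ≈ f 0 * g (suc n) + f 1 * g n
  linear-⊛ f g f≈0 n = +-congˡ (constant-⊛ (f ∘ suc) g f≈0 n)

  cauchyTerms : Series → Series → ∀ n → Fin (suc n) → Carrier
  cauchyTerms f g n i = f (toℕ i) * g (n ∸ toℕ i)

  ⊛-cong : ∀ {f f′ g g′} → f ≋ f′ → g ≋ g′ → (f ⊛ g) ≋ (f′ ⊛ g′)
  ⊛-cong f≋f′ g≋g′ n =
    sum-cong-≋ {suc n} λ i → *-cong (f≋f′ (toℕ i)) (g≋g′ (n ∸ toℕ i))

  ⊛-distribˡ : ∀ f g h → (f ⊛ (g ⊕ h)) ≋ ((f ⊛ g) ⊕ (f ⊛ h))
  ⊛-distribˡ f g h n = trans
    (sum-cong-≋ {suc n} λ i → distribˡ (f (toℕ i)) (g (n ∸ toℕ i)) (h (n ∸ toℕ i)))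
    (∑-distrib-+ (cauchyTerms f g n) (cauchyTerms f h n))

  ⊛-distribʳ : ∀ f g h → ((g ⊕ h) ⊛ f) ≋ ((g ⊛ f) ⊕ (h ⊛ f))
  ⊛-distribʳ f g h n = trans
    (sum-cong-≋ {suc n} λ i → distribʳ (f (n ∸ toℕ i)) (g (toℕ i)) (h (toℕ i)))
    (∑-distrib-+ (cauchyTerms g f n) (cauchyTerms h f n))

  scale-⊛ : ∀ a f g n → ((λ k → a * f k) ⊛ g) n ≈ a * (f ⊛ g) n
  scale-⊛ a f g n = trans
    (sum-cong-≋ {suc n} λ i → *-assoc a (f (toℕ i)) (g (n ∸ toℕ i)))
    (sym (*-distribˡ-sum a (cauchyTerms f g n)))

  -- The product unfolds by its first term; peeling off the last one instead gives the mirror-image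
  -- recursion, which is what commutativity needs.
  ⊛-suc : ∀ f g n → (f ⊛ g) (suc n) ≈ (f ⊛ (g ∘ suc)) n + f (suc n) * g 0
  ⊛-suc f g zero    = +-cong (sym (+-identityʳ _)) (+-identityʳ _)
  ⊛-suc f g (suc n) = trans (+-congˡ (⊛-suc (f ∘ suc) g n)) (sym (+-assoc _ _ _))

  ⊛-comm : ∀ f g → (f ⊛ g) ≋ (g ⊛ f)
  ⊛-comm f g zero    = +-congʳ (*-comm _ _)
  ⊛-comm f g (suc n) = begin
    (f ⊛ g) (suc n)                      ≈⟨ ⊛-suc f g n ⟩
    (f ⊛ (g ∘ suc)) n + f (suc n) * g 0  ≈⟨ +-cong (⊛-comm f (g ∘ suc) n) (*-comm _ _) ⟩
    ((g ∘ suc) ⊛ f) n + g 0 * f (suc n)  ≈⟨ +-comm _ _ ⟩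
    (g ⊛ f) (suc n)                      ∎

  -- Induction on the degree with `f` varying: the tail of `f ⊛ g` is `f 0` times the tail of `g`,
  -- plus the product of the tail of `f` with `g`. The first part is a scaling, the second falls to
  -- the induction hypothesis.
  ⊛-assoc : ∀ f g h → ((f ⊛ g) ⊛ h) ≋ (f ⊛ (g ⊛ h))
  ⊛-assoc f g h zero = begin
    (f 0 * g 0 + 0#) * h 0 + 0#    ≈⟨ +-congʳ (*-congʳ (+-identityʳ _)) ⟩
    (f 0 * g 0) * h 0 + 0#         ≈⟨ +-congʳ (*-assoc _ _ _) ⟩
    f 0 * (g 0 * h 0) + 0#         ≈⟨ +-congʳ (*-congˡ (+-identityʳ _)) ⟨
    f 0 * (g 0 * h 0 + 0#) + 0#    ∎
  ⊛-assoc f g h (suc n) = begin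
    (f 0 * g 0 + 0#) * h (suc n) + (((λ k → f 0 * g (suc k)) ⊕ (f′ ⊛ g)) ⊛ h) n
      ≈⟨ +-cong (trans (*-congʳ (+-identityʳ _)) (*-assoc _ _ _))
                (trans (⊛-distribʳ h (λ k → f 0 * g (suc k)) (f′ ⊛ g) n)
                       (+-cong (scale-⊛ (f 0) g′ h n) (⊛-assoc f′ g h n))) ⟩
    f 0 * (g 0 * h (suc n)) + (f 0 * (g′ ⊛ h) n + (f′ ⊛ (g ⊛ h)) n)
      ≈⟨ +-assoc _ _ _ ⟨
    (f 0 * (g 0 * h (suc n)) + f 0 * (g′ ⊛ h) n) + (f′ ⊛ (g ⊛ h)) n
      ≈⟨ +-congʳ (distribˡ _ _ _) ⟨
    f 0 * (g ⊛ h) (suc n) + (f′ ⊛ (g ⊛ h)) n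
      ∎
    where
    f′ g′ : Series
    f′ = f ∘ suc
    g′ = g ∘ suc

  𝟙-⊛ : ∀ f → (𝟙 ⊛ f) ≋ f
  𝟙-⊛ f n = trans (constant-⊛ 𝟙 f (λ _ → refl) n) (*-identityˡ _)

  commutativeRing : CommutativeRing c ℓ
  commutativeRing = record
    { RawRing seriesRawRing
    ; isCommutativeRing = record
      { isRing = record
        { +-isAbelianGroup = record
          { isGroup = record
            { isMonoid = record
              { isSemigroup = record
                { isMagma = record
                  { isEquivalence = record
                    { refl  = λ n → refl
                    ; sym   = λ p n → sym (p n)
                    ; trans = λ p r n → trans (p n) (r n)
                    }
                  ; ∙-cong = λ p r n → +-cong (p n) (r n)
                  }
                ; assoc = λ f g h n → +-assoc _ _ _
                }
              ; identity = (λ f n → +-identityˡ _) , (λ f n → +-identityʳ _)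
              }
            ; inverse = (λ f n → -‿inverseˡ _) , (λ f n → -‿inverseʳ _)
            ; ⁻¹-cong = λ p n → -‿cong (p n)
            }
          ; comm = λ f g n → +-comm _ _
          }
        ; *-cong     = ⊛-cong
        ; *-assoc    = ⊛-assoc
        ; *-identity = 𝟙-⊛ , λ f n → trans (⊛-comm f 𝟙 n) (𝟙-⊛ f n)
        ; distrib    = ⊛-distribˡ , ⊛-distribʳ
        }
      ; *-comm = ⊛-comm
      }
    }

  ⊛-const : ∀ f a n → (f ⊛ const a) n ≈ f n * a
  ⊛-const f a n = begin
    (f ⊛ const a) n  ≈⟨ ⊛-comm f (const a) n ⟩
    (const a ⊛ f) n  ≈⟨ constant-⊛ (const a) f (λ _ → refl) n ⟩
    a * f n          ≈⟨ *-comm _ _ ⟩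
    f n * a          ∎

  const-cong : ∀ {a b} → a ≈ b → const a ≋ const b
  const-cong a≈b zero    = a≈b
  const-cong a≈b (suc n) = refl

  open RawSemiringDefs (RawRing.rawSemiring rawRing) using (_^_)
  open RawSemiringDefs (RawRing.rawSemiring seriesRawRing) using ()
    renaming (_^_ to _^ₛ_)

  const-^ : ∀ a n → (const a ^ₛ n) ≋ const (a ^ n)
  const-^ a zero    k       = refl
  const-^ a (suc n) k       = trans (constant-⊛ (const a) (const a ^ₛ n) (λ _ → refl) k)
    (trans (*-congˡ (const-^ a n k)) (lem k))
    where
    lem : ∀ k → a * const (a ^ n) k ≈ const (a ^ suc n) k
    lem zero    = refl
    lem (suc k) = zeroʳ a

  -- The Kronecker delta, by recursion on both indices so that it is unchanged by computation when
  -- both are shifted, as happens under multiplication by `X` and under reindexing of sums.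
  δ : ℕ → ℕ → Carrier
  δ zero    zero    = 1#
  δ (suc m) (suc n) = δ m n
  δ _       _       = 0#

  δ-above : ∀ {n a} → a < n → δ n a ≈ 0#
  δ-above {suc n} {zero}  _         = refl
  δ-above {suc n} {suc a} (s≤s a<n) = δ-above a<n

  X-⊛-zero : ∀ f → (X ⊛ f) 0 ≈ 0#
  X-⊛-zero f = trans (+-identityʳ _) (zeroˡ _)

  X-⊛-suc : ∀ f n → (X ⊛ f) (suc n) ≈ f n
  X-⊛-suc f n = begin
    (X ⊛ f) (suc n)                ≈⟨ linear-⊛ X f (λ _ → refl) n ⟩
    0# * f (suc n) + 1# * f n      ≈⟨ +-cong (zeroˡ _) (*-identityˡ _) ⟩
    0# + f n                       ≈⟨ +-identityˡ _ ⟩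
    f n                            ∎

  X-^ : ∀ m n → (X ^ₛ m) n ≈ δ m n
  X-^ zero    zero    = refl
  X-^ zero    (suc n) = refl
  X-^ (suc m) zero    = X-⊛-zero (X ^ₛ m)
  X-^ (suc m) (suc n) = trans (X-⊛-suc (X ^ₛ m) n) (X-^ m n)

  X-^-⊛-low : ∀ m f n → n < m → ((X ^ₛ m) ⊛ f) n ≈ 0#
  X-^-⊛-low (suc m) f zero    _         =
    trans (⊛-assoc X (X ^ₛ m) f 0) (X-⊛-zero ((X ^ₛ m) ⊛ f))
  X-^-⊛-low (suc m) f (suc n) (s≤s n<m) = begin
    ((X ⊛ (X ^ₛ m)) ⊛ f) (suc n)  ≈⟨ ⊛-assoc X (X ^ₛ m) f (suc n) ⟩
    (X ⊛ ((X ^ₛ m) ⊛ f)) (suc n)  ≈⟨ X-⊛-suc ((X ^ₛ m) ⊛ f) n ⟩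
    ((X ^ₛ m) ⊛ f) n              ≈⟨ X-^-⊛-low m f n n<m ⟩
    0#                            ∎

  infix 4 _≈[_]_
  _≈[_]_ : Series → ℕ → Series → Set ℓ
  f ≈[ n ] g = ∀ d → d < n → f d ≈ g d

  -- In degree d a product involves only coefficients of degree at most d, so congruence modulo Xⁿ
  -- survives multiplication.
  ⊛-congˡ-≈[] : ∀ h {f g n} → f ≈[ n ] g → (h ⊛ f) ≈[ n ] (h ⊛ g)
  ⊛-congˡ-≈[] h f≈g d d<n = sum-cong-≋ {suc d} λ i →
    *-congˡ {h (toℕ i)} (f≈g (d ∸ toℕ i) (ℕ.≤-<-trans (ℕ.m∸n≤m d (toℕ i)) d<n))

-- Arithmetic of n choose 2.

C₂-suc : ∀ n → suc n C 2 ≡ n ℕ.+ n C 2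
C₂-suc n = ≡.trans (≡.sym (nCk+nC[k+1]≡[n+1]C[k+1] n 1)) (≡.cong (ℕ._+ n C 2) (nC1≡n n))

-- A pair from a disjoint union lies in one part, in the other, or has one element in each. The
-- proof is by induction through Pascal's rule.
C₂-+ : ∀ m n → (m ℕ.+ n) C 2 ≡ m C 2 ℕ.+ n C 2 ℕ.+ m ℕ.* n
C₂-+ zero    n = ≡.sym (ℕ.+-identityʳ _)
C₂-+ (suc m) n = begin
  suc (m ℕ.+ n) C 2                                   ≡⟨ C₂-suc (m ℕ.+ n) ⟩
  m ℕ.+ n ℕ.+ (m ℕ.+ n) C 2                           ≡⟨ ≡.cong (m ℕ.+ n ℕ.+_) (C₂-+ m n) ⟩
  m ℕ.+ n ℕ.+ (m C 2 ℕ.+ n C 2 ℕ.+ m ℕ.* n)           ≡⟨ regroup m n (m C 2) (n C 2) (m ℕ.* n) ⟩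
  m ℕ.+ m C 2 ℕ.+ n C 2 ℕ.+ (n ℕ.+ m ℕ.* n)
    ≡⟨ ≡.cong (λ k → k ℕ.+ n C 2 ℕ.+ (n ℕ.+ m ℕ.* n)) (C₂-suc m) ⟨
  suc m C 2 ℕ.+ n C 2 ℕ.+ suc m ℕ.* n                 ∎
  where
  open ≡.≡-Reasoning
  regroup : ∀ m n a b k → m ℕ.+ n ℕ.+ (a ℕ.+ b ℕ.+ k) ≡ m ℕ.+ a ℕ.+ b ℕ.+ (n ℕ.+ k)
  regroup = solve-∀

-- Finite sums and products.

module FiniteSums {c ℓ} (R : CommutativeRing c ℓ) where
  open CommutativeRing R hiding (zero)
  open SemiringSum semiring using (sum; sum-cong-≋; sum-replicate-zero; *-distribˡ-sum)
  open RawSemiringDefs (RawRing.rawSemiring rawRing) using (product)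
  open SeriesProperties R using (δ)
  open SetoidReasoning setoid

  sum-zero : ∀ n {t : Fin n → Carrier} → (∀ i → t i ≈ 0#) → sum t ≈ 0#
  sum-zero n t≈0 = trans (sum-cong-≋ t≈0) (sum-replicate-zero n)

  product-suc : ∀ n (g : ℕ → Carrier) →
    product {suc n} (g ∘ toℕ) ≈ product {n} (g ∘ toℕ) * g n
  product-suc zero    g = *-comm _ _
  product-suc (suc n) g =
    trans (*-congˡ (product-suc n (g ∘ suc))) (sym (*-assoc _ _ _))

  sum-δ : ∀ {N} b (f : ℕ → Carrier) → b < N →
    sum {N} (λ k → δ (toℕ k) b * f (toℕ k)) ≈ f b
  sum-δ {suc N} zero f _ = begin
    1# * f 0 + sum {N} (λ k → 0# * f (suc (toℕ k)))
      ≈⟨ +-cong (*-identityˡ _) (sum-zero N λ _ → zeroˡ _) ⟩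
    f 0 + 0#                                         ≈⟨ +-identityʳ _ ⟩
    f 0                                              ∎
  sum-δ {suc N} (suc b) f (s≤s b<N) = begin
    0# * f 0 + sum {N} (λ k → δ (toℕ k) b * f (suc (toℕ k)))
      ≈⟨ +-cong (zeroˡ _) (sum-δ b (f ∘ suc) b<N) ⟩
    0# + f (suc b)                                           ≈⟨ +-identityˡ _ ⟩
    f (suc b)                                                ∎

  -- Row 0 contributes only j = a, and the remaining rows form the antidiagonal for a - 1 of the
  -- shifted `f`. The bounds keep the whole antidiagonal inside the box.
  sum-δ-antidiagonal : ∀ {M N} a (f : ℕ → ℕ → Carrier) → a < M → a < N →
    sum {M} (λ i → sum {N} λ j → δ (toℕ i ℕ.+ toℕ j) a * f (toℕ i) (toℕ j)) ≈
    sum {suc a} (λ i → f (toℕ i) (a ∸ toℕ i))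
  sum-δ-antidiagonal {suc M} {N} zero f _ a<N =
    +-cong (sum-δ zero (f 0) a<N)
           (sum-zero M λ i → sum-zero N λ j → zeroˡ _)
  sum-δ-antidiagonal {suc M} (suc a) f (s≤s a<M) a<N =
    +-cong (sum-δ (suc a) (f 0) a<N)
           (sum-δ-antidiagonal a (f ∘ suc) a<M (ℕ.<-trans (ℕ.n<1+n a) a<N))

-- Reciprocals of (Q;Q)ₙ are supplied as data, so the q-identities can be proved in an arbitrary
-- commutative ring, without division.
InversePochhammers : ∀ {c ℓ} (A : CommutativeRing c ℓ) → let open CommutativeRing A in
  Carrier → (ℕ → Carrier) → Set ℓ
InversePochhammers A Q r = ∀ n → ⟨ Q ⨾ Q ⟩ n * r n ≈ 1#
  where
  open CommutativeRing A
  open Pochhammer (CommutativeRing.rawRing A)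

-- q-identities in a ring where every (q²;q²)ₙ is invertible.

module QIdentities {c ℓ} (A : CommutativeRing c ℓ)
  (q : CommutativeRing.Carrier A) (r : ℕ → CommutativeRing.Carrier A)
  (r-inverse : InversePochhammers A
    (RawSemiringDefs._^_ (RawRing.rawSemiring (CommutativeRing.rawRing A)) q 2) r) where

  open CommutativeRing A hiding (zero)
  open RawSemiringDefs (RawRing.rawSemiring rawRing) using (_^_)
  open Pochhammer rawRing
  open RingProperties ring
    using (-1*x≈-x; +-identityˡ-unique)
  open Exp commutativeSemiring using (^-congʳ; ^-homo-*; ^-assocʳ)
  open SemiringSum semiring using (sum; sum-cong-≋; *-distribˡ-sum)
  open FiniteSums A
  open PowerSeries rawRing using (_⊛_; Series)
  open SeriesProperties A using (cauchyTerms; ⊛-cong; ⊛-comm; ⊛-assoc; linear-⊛)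
  open Solver commutativeSemiring
  open SetoidReasoning setoid

  private
    Q : Carrier
    Q = q ^ 2

  -- This is (1 - Qⁿ⁺¹) / (Q;Q)ₙ₊₁ = 1 / (Q;Q)ₙ, rearranged without subtraction so that the semiring
  -- solver can work with it.
  r-suc : ∀ n → r (suc n) ≈ r n + Q ^ suc n * r (suc n)
  r-suc n = begin
    r (suc n)                                              ≈⟨ *-identityˡ _ ⟨
    1# * r (suc n)                                         ≈⟨ *-congʳ split ⟨
    (f + Q ^ suc n) * r (suc n)                            ≈⟨ distribʳ _ _ _ ⟩
    f * r (suc n) + Q ^ suc n * r (suc n)                  ≈⟨ +-congʳ f*r ⟩
    r n + Q ^ suc n * r (suc n)                            ∎
    where
    D : ℕ → Carrier
    D = ⟨ Q ⨾ Q ⟩_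
    f : Carrier
    f = 1# + - (Q ^ suc n)
    split : f + Q ^ suc n ≈ 1#
    split = trans (+-assoc _ _ _) (trans (+-congˡ (-‿inverseˡ _)) (+-identityʳ _))
    f*r : f * r (suc n) ≈ r n
    f*r = begin
      -- Inserting (Q;Q)ₙ · `r n` = 1 completes `f` to (Q;Q)ₙ₊₁, which cancels `r (suc n)`.
      f * r (suc n)                    ≈⟨ *-identityʳ _ ⟨
      f * r (suc n) * 1#               ≈⟨ *-congˡ (r-inverse n) ⟨
      f * r (suc n) * (D n * r n)
        ≈⟨ solve 4 (λ f r′ d r → f :* r′ :* (d :* r) := d :* f :* r′ :* r)
             refl f (r (suc n)) (D n) (r n) ⟩
      D n * f * r (suc n) * r n
        ≈⟨ *-congʳ (*-congʳ (product-suc n λ k → 1# + - (Q * Q ^ k))) ⟨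
      D (suc n) * r (suc n) * r n      ≈⟨ *-congʳ (r-inverse (suc n)) ⟩
      1# * r n                         ≈⟨ *-identityˡ _ ⟩
      r n                              ∎

  -- The factor 1 - Qⁿ⁺¹ can be cancelled because it divides an invertible Pochhammer symbol. In
  -- terms of `r`: the hypothesis and `r-suc` force `r n * t` to vanish, and `r n` is invertible.
  fixed⇒0 : ∀ n t → Q ^ suc n * t ≈ t → t ≈ 0#
  fixed⇒0 n t fixed = begin
    t                          ≈⟨ *-identityˡ _ ⟨
    1# * t                     ≈⟨ *-congʳ (r-inverse n) ⟨
    ⟨ Q ⨾ Q ⟩ n * r n * t      ≈⟨ *-assoc _ _ _ ⟩
    ⟨ Q ⨾ Q ⟩ n * (r n * t)    ≈⟨ *-congˡ (+-identityˡ-unique (r n * t) (r (suc n) * t) r*t) ⟩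
    ⟨ Q ⨾ Q ⟩ n * 0#           ≈⟨ zeroʳ _ ⟩
    0#                         ∎
    where
    r*t : r n * t + r (suc n) * t ≈ r (suc n) * t
    r*t = begin
      r n * t + r (suc n) * t                  ≈⟨ +-congˡ (*-congˡ fixed) ⟨
      r n * t + r (suc n) * (Q ^ suc n * t)
        ≈⟨ solve 4 (λ r r′ w t → r :* t :+ r′ :* (w :* t) := (r :+ w :* r′) :* t)
             refl (r n) (r (suc n)) (Q ^ suc n) t ⟩
      (r n + Q ^ suc n * r (suc n)) * t        ≈⟨ *-congʳ (r-suc n) ⟨
      r (suc n) * t                            ∎

  ^2-^ : ∀ n → Q ^ n ≈ q ^ n * q ^ n
  ^2-^ n = trans (^-assocʳ q 2 n)
    (trans (^-congʳ q (≡.cong (n ℕ.+_) (ℕ.+-identityʳ n))) (^-homo-* q n n))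

  ^-C₂-suc : ∀ a n → a ^ (suc n C 2) ≈ a ^ n * a ^ (n C 2)
  ^-C₂-suc a n = trans (^-congʳ a (C₂-suc n)) (^-homo-* a n (n C 2))

  -- The coefficients of (z;q²)∞ and 1/(z;q²)∞ at zⁿ are u n and r n.
  u : Series
  u n = (- 1#) ^ n * Q ^ (n C 2) * r n

  -- z ↦ q² z
  dilate : Series → Series
  dilate f n = Q ^ n * f n

  dilate-⊛ : ∀ f g n → dilate (f ⊛ g) n ≈ (dilate f ⊛ dilate g) n
  dilate-⊛ f g n = trans (*-distribˡ-sum (Q ^ n) (cauchyTerms f g n)) (sum-cong-≋ {suc n} λ i →
    let k = toℕ i; k≤n = ℕ.≤-pred (toℕ<n i) in begin
    Q ^ n * (f k * g (n ∸ k))                    ≈⟨ *-congʳ (^-congʳ Q (ℕ.m+[n∸m]≡n k≤n)) ⟨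
    Q ^ (k ℕ.+ (n ∸ k)) * (f k * g (n ∸ k))      ≈⟨ *-congʳ (^-homo-* Q k (n ∸ k)) ⟩
    Q ^ k * Q ^ (n ∸ k) * (f k * g (n ∸ k))
      ≈⟨ solve 4 (λ a b c d → a :* b :* (c :* d) := a :* c :* (b :* d))
           refl (Q ^ k) (Q ^ (n ∸ k)) (f k) (g (n ∸ k)) ⟩
    Q ^ k * f k * (Q ^ (n ∸ k) * g (n ∸ k))      ∎)

  1-z : Series
  1-z 0 = 1#
  1-z 1 = - 1#
  1-z _ = 0#

  1-z-⊛-zero : ∀ f → (1-z ⊛ f) 0 ≈ f 0
  1-z-⊛-zero f = trans (+-identityʳ _) (*-identityˡ _)

  1-z-⊛-suc : ∀ f n → (1-z ⊛ f) (suc n) ≈ f (suc n) + - 1# * f n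
  1-z-⊛-suc f n = trans (linear-⊛ 1-z f (λ _ → refl) n) (+-congʳ (*-identityˡ _))

  -- The functional equation (z;q²)∞ = (1 - z) (q²z;q²)∞ in coefficients; it comes from `r-suc` and
  -- the recursion for n choose 2.
  u-dilate : ∀ n → u n ≈ (1-z ⊛ dilate u) n
  u-dilate zero    = sym (trans (1-z-⊛-zero (dilate u)) (*-identityˡ _))
  u-dilate (suc n) = begin
    s * r (suc n)                                        ≈⟨ *-congˡ (r-suc n) ⟩
    s * (r n + Q ^ suc n * r (suc n))
      ≈⟨ solve 4 (λ s r w r′ → s :* (r :+ w :* r′) := w :* (s :* r′) :+ s :* r)
           refl s (r n) (Q ^ suc n) (r (suc n)) ⟩
    dilate u (suc n) + s * r n
      ≈⟨ +-congˡ (*-congʳ (*-congˡ (^-C₂-suc Q n))) ⟩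
    dilate u (suc n) + - 1# * ε * (Q ^ n * Q ^ (n C 2)) * r n
      ≈⟨ +-congˡ (solve 5 (λ m e a b r → m :* e :* (a :* b) :* r := m :* (a :* (e :* b :* r)))
           refl (- 1#) ε (Q ^ n) (Q ^ (n C 2)) (r n)) ⟩
    dilate u (suc n) + - 1# * dilate u n                 ≈⟨ 1-z-⊛-suc (dilate u) n ⟨
    (1-z ⊛ dilate u) (suc n)                             ∎
    where
    ε s : Carrier
    ε = (- 1#) ^ n
    s = (- 1#) ^ suc n * Q ^ (suc n C 2)

  -- The reciprocal functional equation 1/(q²z;q²)∞ = (1 - z)/(z;q²)∞, which is `r-suc` read
  -- coefficientwise.
  r-dilate : ∀ n → dilate r n ≈ (1-z ⊛ r) n
  r-dilate zero    = trans (*-identityˡ _) (sym (1-z-⊛-zero r))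
  r-dilate (suc n) = begin
    Q ^ suc n * r (suc n)                          ≈⟨ +-identityˡ _ ⟨
    0# + Q ^ suc n * r (suc n)
      ≈⟨ +-congʳ (trans (+-congˡ (-1*x≈-x _)) (-‿inverseʳ _)) ⟨
    r n + - 1# * r n + Q ^ suc n * r (suc n)
      ≈⟨ solve 3 (λ a b c → a :+ b :+ c := a :+ c :+ b)
           refl (r n) (- 1# * r n) (Q ^ suc n * r (suc n)) ⟩
    r n + Q ^ suc n * r (suc n) + - 1# * r n       ≈⟨ +-congʳ (r-suc n) ⟨
    r (suc n) + - 1# * r n                   ≈⟨ 1-z-⊛-suc r n ⟨
    (1-z ⊛ r) (suc n)                        ∎

  -- F(z) = (z;q²)∞ · 1/(z;q²)∞ satisfies F(q²z) = F(z), so it is constant.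
  u⊛r-suc : ∀ n → (u ⊛ r) (suc n) ≈ 0#
  u⊛r-suc n = fixed⇒0 n _ (sym (invariant (suc n)))
    where
    invariant : ∀ n → (u ⊛ r) n ≈ dilate (u ⊛ r) n
    invariant n = begin
      (u ⊛ r) n                          ≈⟨ ⊛-cong {g = r} u-dilate (λ _ → refl) n ⟩
      -- The factor 1 - z now passes from the left series to `r`, where it produces `dilate r`.
      ((1-z ⊛ dilate u) ⊛ r) n           ≈⟨ ⊛-cong {g = r} (⊛-comm 1-z (dilate u)) (λ _ → refl) n ⟩
      ((dilate u ⊛ 1-z) ⊛ r) n           ≈⟨ ⊛-assoc (dilate u) 1-z r n ⟩
      (dilate u ⊛ (1-z ⊛ r)) n           ≈⟨ ⊛-cong {dilate u} (λ _ → refl) r-dilate n ⟨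
      (dilate u ⊛ dilate r) n            ≈⟨ dilate-⊛ u r n ⟨
      dilate (u ⊛ r) n                   ∎

  r-zero : r 0 ≈ 1#
  r-zero = trans (sym (*-identityˡ _)) (r-inverse 0)

  u⊛r-zero : (u ⊛ r) 0 ≈ 1#
  u⊛r-zero = begin
    1# * 1# * r 0 * r 0 + 0#     ≈⟨ +-identityʳ _ ⟩
    1# * 1# * r 0 * r 0          ≈⟨ *-cong (*-congˡ r-zero) r-zero ⟩
    1# * 1# * 1# * 1#            ≈⟨ solve 0 (con 1 :* con 1 :* con 1 :* con 1 := con 1) refl ⟩
    1#                           ∎

  -- Euler's coefficients and the factorisation of the summand.

  private
    -- A copy of the exponent in the theorem, with the same body so that the two agree by
    -- computation when this module is applied.
    exponent : ℕ → ℕ → ℕ → ℕ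
    exponent i j n =
      3 ℕ.* (i C 2) ℕ.+ (j C 2) ℕ.+ (n C 2) ℕ.+ i ℕ.* j ℕ.+ j ℕ.* n ℕ.+ n ℕ.* i

  -- The coefficient of yⁿ in (-y;q)∞, that is q^(n choose 2) / (q;q)ₙ.
  euler : Series
  euler n = q ^ (n C 2) * ⟨ - q ⨾ q ⟩ n * r n

  -- The constant term of (-qˢy;q)∞. The trivial power of `q` is kept to match the general form at b
  -- = 0 in the induction on products.
  euler-zero : ∀ s → q ^ (s ℕ.* 0) * euler 0 ≈ 1#
  euler-zero s = begin
    q ^ (s ℕ.* 0) * (1# * 1# * r 0)    ≈⟨ *-cong (^-congʳ q (ℕ.*-zeroʳ s)) (*-congˡ r-zero) ⟩
    1# * (1# * 1# * 1#)
      ≈⟨ solve 0 (con 1 :* (con 1 :* con 1 :* con 1) := con 1) refl ⟩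
    1#                                 ∎

  -- Compares coefficients in (-y;q)∞ = (1 + y) (-qy;q)∞. With v = qⁿ⁺¹ one has Qⁿ⁺¹ = v², so
  -- `r-suc` becomes (1 + v) r′ = v (1 + v) r′ + `r n`; the factor 1 + v is the last one of
  -- (-q;q)ₙ₊₁.
  euler-suc : ∀ n → euler (suc n) ≈ q ^ suc n * euler (suc n) + q ^ n * euler n
  euler-suc n = begin
    e′ * P′ * r′                                         ≈⟨ *-congʳ (*-cong (^-C₂-suc q n) P-suc) ⟩
    a * e * (P * (1# + v)) * r′
      ≈⟨ solve 5 (λ a e P v r′ → a :* e :* (P :* (con 1 :+ v)) :* r′ := a :* e :* P :* (v :* r′ :+ r′))
           refl a e P v r′ ⟩
    a * e * P * (v * r′ + r′)
      ≈⟨ *-congˡ (+-congˡ (trans (r-suc n) (+-congˡ (*-congʳ (^2-^ (suc n)))))) ⟩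
    a * e * P * (v * r′ + (r n + v * v * r′))
      ≈⟨ solve 6 (λ a e P v r r′ → a :* e :* P :* (v :* r′ :+ (r :+ v :* v :* r′)) := v :* (a :* e :* (P :* (con 1 :+ v)) :* r′) :+ a :* (e :* P :* r))
           refl a e P v (r n) r′ ⟩
    v * (a * e * (P * (1# + v)) * r′) + a * (e * P * r n)
      ≈⟨ +-congʳ (*-congˡ (*-congʳ (*-cong (^-C₂-suc q n) P-suc))) ⟨
    v * (e′ * P′ * r′) + a * (e * P * r n)               ∎
    where
    a e e′ v P P′ r′ : Carrier
    a  = q ^ n
    e  = q ^ (n C 2)
    e′ = q ^ (suc n C 2)
    v  = q ^ suc n
    P  = ⟨ - q ⨾ q ⟩ n
    P′ = ⟨ - q ⨾ q ⟩ (suc n)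
    r′ = r (suc n)
    P-suc : P′ ≈ P * (1# + v)
    P-suc = trans (product-suc n λ k → 1# + - (- q * q ^ k)) (*-congˡ (1-[-x]y≈1+xy A q a))

  -- The coefficients of (-qˢy;q)∞ = (1 + qˢy) (-qˢ⁺¹y;q)∞.
  euler-shift : ∀ s n → q ^ (s ℕ.* suc n) * euler (suc n) ≈
    q ^ (suc s ℕ.* suc n) * euler (suc n) + q ^ s * (q ^ (suc s ℕ.* n) * euler n)
  euler-shift s n = begin
    b * euler (suc n)                                  ≈⟨ *-congˡ (euler-suc n) ⟩
    b * (q ^ suc n * euler (suc n) + q ^ n * euler n)
      ≈⟨ solve 5 (λ b v L a L′ → b :* (v :* L :+ a :* L′) := v :* b :* L :+ a :* b :* L′)
           refl b (q ^ suc n) (euler (suc n)) (q ^ n) (euler n) ⟩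
    q ^ suc n * b * euler (suc n) + q ^ n * b * euler n
      ≈⟨ +-cong (*-congʳ (sym (^-homo-* q (suc n) (s ℕ.* suc n))))
                (trans (*-congʳ exps) (*-assoc _ _ _)) ⟩
    q ^ (suc s ℕ.* suc n) * euler (suc n) + q ^ s * (q ^ (suc s ℕ.* n) * euler n) ∎
    where
    b : Carrier
    b = q ^ (s ℕ.* suc n)
    regroup : ∀ s n → n ℕ.+ s ℕ.* suc n ≡ s ℕ.+ suc s ℕ.* n
    regroup = solve-∀
    exps : q ^ n * b ≈ q ^ s * q ^ (suc s ℕ.* n)
    exps = trans (sym (^-homo-* q n _)) (trans (^-congʳ q (regroup s n)) (^-homo-* q s _))

  -- Meant for z the reciprocal of the whole denominator, which the theorem takes as one series;
  -- uniqueness of inverses splits it into three.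
  r-product : ∀ i j n z → ⟨ Q ⨾ Q ⟩ i * ⟨ Q ⨾ Q ⟩ j * ⟨ Q ⨾ Q ⟩ n * z ≈ 1# →
              z ≈ r i * r j * r n
  r-product i j n z inverse = inverse-unique A (D i * D j * D n) z _ inverse (begin
    D i * D j * D n * (r i * r j * r n)
      ≈⟨ solve 6 (λ a b c x y z → a :* b :* c :* (x :* y :* z) := a :* x :* (b :* y) :* (c :* z))
           refl (D i) (D j) (D n) (r i) (r j) (r n) ⟩
    D i * r i * (D j * r j) * (D n * r n)
      ≈⟨ *-cong (*-cong (r-inverse i) (r-inverse j)) (r-inverse n) ⟩
    1# * 1# * 1#                             ≈⟨ solve 0 (con 1 :* con 1 :* con 1 := con 1) refl ⟩
    1#                                       ∎)
    where
    D : ℕ → Carrier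
    D = ⟨ Q ⨾ Q ⟩_

  -- Collects what depends on i and j only through m = i + j, and so is constant along an
  -- antidiagonal.
  prefactor : ℕ → ℕ → Carrier
  prefactor m n = q ^ (m C 2 ℕ.+ n C 2 ℕ.+ m ℕ.* n) * ⟨ - q ⨾ q ⟩ (m ℕ.+ n) * r n

  prefactor-zero : ∀ n → prefactor 0 n ≈ euler n
  prefactor-zero n = *-congʳ (*-congʳ (^-congʳ q (ℕ.+-identityʳ (n C 2))))

  -- In the exponent j n + n i is (i + j) n, and `C₂-+` absorbs i j into (i + j) choose 2. What
  -- remains is 2 (i choose 2), the power of `q` in `u i`.
  summand-factorisation : ∀ i j n →
    (- 1#) ^ i * q ^ exponent i j n * ⟨ - q ⨾ q ⟩ (i ℕ.+ j ℕ.+ n) * (r i * r j * r n) ≈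
    prefactor (i ℕ.+ j) n * (u i * r j)
  summand-factorisation i j n = begin
    m * q ^ exponent i j n * P * (r i * r j * r n)
      ≈⟨ *-congʳ (*-congʳ (*-congˡ exps)) ⟩
    m * (a * b) * P * (r i * r j * r n)
      ≈⟨ solve 7 (λ m a b P x y z → m :* (a :* b) :* P :* (x :* y :* z) := a :* P :* z :* (m :* b :* x :* y))
           refl m a b P (r i) (r j) (r n) ⟩
    a * P * r n * (m * b * r i * r j)              ∎
    where
    m P a b : Carrier
    m = (- 1#) ^ i
    P = ⟨ - q ⨾ q ⟩ (i ℕ.+ j ℕ.+ n)
    k : ℕ
    k = (i ℕ.+ j) C 2 ℕ.+ n C 2 ℕ.+ (i ℕ.+ j) ℕ.* n
    a = q ^ k
    b = Q ^ (i C 2)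
    regroup : ∀ x y z i j n → 3 ℕ.* x ℕ.+ y ℕ.+ z ℕ.+ i ℕ.* j ℕ.+ j ℕ.* n ℕ.+ n ℕ.* i ≡
      x ℕ.+ y ℕ.+ i ℕ.* j ℕ.+ z ℕ.+ (i ℕ.+ j) ℕ.* n ℕ.+ 2 ℕ.* x
    regroup = solve-∀
    exponent≡ : exponent i j n ≡ k ℕ.+ 2 ℕ.* (i C 2)
    exponent≡ = ≡.trans (regroup (i C 2) (j C 2) (n C 2) i j n)
      (≡.cong (λ l → l ℕ.+ n C 2 ℕ.+ (i ℕ.+ j) ℕ.* n ℕ.+ 2 ℕ.* (i C 2)) (≡.sym (C₂-+ i j)))
    exps : q ^ exponent i j n ≈ a * b
    exps = begin
      q ^ exponent i j n           ≈⟨ ^-congʳ q exponent≡ ⟩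
      q ^ (k ℕ.+ 2 ℕ.* (i C 2))    ≈⟨ ^-homo-* q k _ ⟩
      a * q ^ (2 ℕ.* (i C 2))      ≈⟨ *-congˡ (^-assocʳ q 2 (i C 2)) ⟨
      a * b                        ∎

  antidiagonal-sum : ∀ a n (t : ℕ → ℕ → Carrier) →
    (∀ i j → t i j ≈ prefactor (i ℕ.+ j) n * (u i * r j)) →
    sum {suc a} (λ i → t (toℕ i) (a ∸ toℕ i)) ≈ prefactor a n * (u ⊛ r) a
  antidiagonal-sum a n t t≈ = trans
    (sum-cong-≋ {suc a} λ i → trans (t≈ (toℕ i) (a ∸ toℕ i))
      -- Since i ≤ a, the truncated difference is genuine and i + (a ∸ i) is a.
      (*-congʳ (reflexive (≡.cong (λ m → prefactor m n) (ℕ.m+[n∸m]≡n (ℕ.≤-pred (toℕ<n i)))))))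
    (sym (*-distribˡ-sum (prefactor a n) (cauchyTerms u r a)))

-- Specialisation to power series in q, and the common value of both sides.

module Sides {c ℓ} (R : CommutativeRing c ℓ) where
  open Identity R

  module R = CommutativeRing R
  module R[q] = SeriesProperties R
  module K[y] = SeriesProperties R[q].commutativeRing
  module K[y][x] = SeriesProperties K[y].commutativeRing

  module S = CommutativeRing K[y][x].commutativeRing
  module Ky = CommutativeRing K[y].commutativeRing
  open CommutativeRing R[q].commutativeRing hiding (zero; -_)
  open RawSemiringDefs (RawRing.rawSemiring K) using (_^_)
  open RawSemiringDefs (RawRing.rawSemiring S) using ()
    renaming (_^_ to _^ₛ_; sum to sumₛ; product to productₛ)
  open RawSemiringDefs (RawRing.rawSemiring K⟦y⟧.rawRing) using ()
    renaming (_^_ to _^ᵧ_)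
  open SemiringSum semiring using (sum; sum-cong-≋; *-distribˡ-sum)
  open RawRing K⟦y⟧.rawRing using () renaming (_*_ to _⊛ᵧ_)
  open FiniteSums R[q].commutativeRing
  open K[y] using (δ; δ-above)
  open Pochhammer K using (⟨_⨾_⟩_)
  open SetoidReasoning setoid

  -- The denominator at (n, 0, 0) is (q²;q²)ₙ times two empty products; in this form `denominator-0`
  -- provides the constant term 1 that `recip-inverse` requires.
  r : ℕ → RawRing.Carrier K
  r n = R⟦q⟧.recip (denominator n 0 0)

  r-inverse : InversePochhammers R[q].commutativeRing (𝐪 ^ 2) r
  r-inverse n = begin
    D n * r n
      ≈⟨ *-congʳ {r n} {denominator n 0 0} {D n} (trans (*-identityʳ (D n * 1#)) (*-identityʳ (D n))) ⟨
    denominator n 0 0 * r n        ≈⟨ recip-inverse R _ (denominator-0 R n 0 0) ⟩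
    1#                             ∎
    where
    D : ℕ → RawRing.Carrier K
    D = ⟨ 𝐪 ^ 2 ⨾ 𝐪 ^ 2 ⟩_

  open QIdentities R[q].commutativeRing 𝐪 r r-inverse

  -- The infinite product is given only as a limit, so its expected expansion is written down and
  -- then shown to be both the limit and the sum.
  P : ∣S∣
  P zero    b = euler b
  P (suc _) b = 0#

  -- The infinite product.

  factor : ℕ → ∣S∣
  factor k = S.1# S.+ - (- y S.* q ^ₛ k)

  LinearFactor : ℕ → ∣S∣ → Set ℓ
  LinearFactor k t = ∀ a b → t a b ≈ S.1# a b + y a b * 𝐪 ^ k

  factor-linear : ∀ k → LinearFactor k (factor k)
  factor-linear k a b = begin
    factor k a b                       ≈⟨ 1-[-x]y≈1+xy K[y][x].commutativeRing y (q ^ₛ k) a b ⟩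
    S.1# a b + (y S.* q ^ₛ k) a b      ≈⟨ +-congˡ (S.*-congˡ {y} q^k a b) ⟩
    S.1# a b + (y S.* ι (𝐪 ^ k)) a b   ≈⟨ +-congˡ (K[y][x].⊛-const y (K⟦y⟧.const (𝐪 ^ k)) a b) ⟩
    S.1# a b + (y a Ky.* K⟦y⟧.const (𝐪 ^ k)) b
                                       ≈⟨ +-congˡ (K[y].⊛-const (y a) (𝐪 ^ k) b) ⟩
    S.1# a b + y a b * 𝐪 ^ k           ∎
    where
    q^k : (q ^ₛ k) S.≈ ι (𝐪 ^ k)
    q^k = S.trans (K[y][x].const-^ (K⟦y⟧.const 𝐪) k)
                  (K[y][x].const-cong (K[y].const-^ 𝐪 k))

  module _ (k : ℕ) (t : ∣S∣) (t-linear : LinearFactor k t) where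

    linear-x : ∀ a → t (suc a) Ky.≈ Ky.0#
    linear-x a b = trans (t-linear (suc a) b) (trans (+-congˡ (zeroˡ (𝐪 ^ k))) (+-identityʳ 0#))

    linear-yy : ∀ b → t 0 (suc (suc b)) ≈ 0#
    linear-yy b = trans (t-linear 0 (suc (suc b))) (trans (+-congˡ (zeroˡ (𝐪 ^ k))) (+-identityʳ 0#))

    linear-1 : t 0 0 ≈ 1#
    linear-1 = trans (t-linear 0 0) (trans (+-congˡ (zeroˡ (𝐪 ^ k))) (+-identityʳ 1#))

    linear-y : t 0 1 ≈ 𝐪 ^ k
    linear-y = trans (t-linear 0 1) (trans (+-identityˡ (1# * 𝐪 ^ k)) (*-identityˡ (𝐪 ^ k)))

    linear-*-x : ∀ g a → g (suc a) Ky.≈ Ky.0# → (t S.* g) (suc a) Ky.≈ Ky.0#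
    linear-*-x g a g≈0 = Ky.trans (K[y][x].constant-⊛ t g linear-x (suc a))
      (Ky.trans (Ky.*-congˡ {t 0} g≈0) (Ky.zeroʳ (t 0)))

    linear-*-1 : ∀ g → (t S.* g) 0 0 ≈ g 0 0
    linear-*-1 g = begin
      (t S.* g) 0 0        ≈⟨ K[y][x].constant-⊛ t g linear-x 0 0 ⟩
      (t 0 Ky.* g 0) 0     ≈⟨ +-identityʳ _ ⟩
      t 0 0 * g 0 0        ≈⟨ *-congʳ {g 0 0} linear-1 ⟩
      1# * g 0 0           ≈⟨ *-identityˡ (g 0 0) ⟩
      g 0 0                ∎

    linear-*-y : ∀ g b → (t S.* g) 0 (suc b) ≈ g 0 (suc b) + 𝐪 ^ k * g 0 b
    linear-*-y g b = begin
      (t S.* g) 0 (suc b)                      ≈⟨ K[y][x].constant-⊛ t g linear-x 0 (suc b) ⟩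
      (t 0 Ky.* g 0) (suc b)                   ≈⟨ K[y].linear-⊛ (t 0) (g 0) linear-yy b ⟩
      t 0 0 * g 0 (suc b) + t 0 1 * g 0 b
        ≈⟨ +-cong (*-congʳ {g 0 (suc b)} linear-1) (*-congʳ {g 0 b} linear-y) ⟩
      1# * g 0 (suc b) + 𝐪 ^ k * g 0 b         ≈⟨ +-congʳ (*-identityˡ (g 0 (suc b))) ⟩
      g 0 (suc b) + 𝐪 ^ k * g 0 b              ∎

  -- The factors of (-qˢy;q)ₙ are described by a property instead of a formula: dropping the first
  -- one leaves a family of the same kind with s raised by one, and no product has to be rewritten.
  LinearFactors : ℕ → (ℕ → ∣S∣) → Set ℓ
  LinearFactors s t = ∀ k → LinearFactor (k ℕ.+ s) (t k)

  shift : ∀ s t → LinearFactors s t → LinearFactors (suc s) (t ∘ suc)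
  shift s t t-linear k =
    ≡.subst (λ j → LinearFactor j (t (suc k))) (≡.sym (ℕ.+-suc k s)) (t-linear (suc k))

  product-x : ∀ n s t → LinearFactors s t →
              ∀ a → productₛ {n} (t ∘ toℕ) (suc a) Ky.≈ Ky.0#
  product-x zero    s t t-linear a = Ky.refl
  product-x (suc n) s t t-linear a =
    linear-*-x s (t 0) (t-linear 0) (productₛ {n} (t ∘ suc ∘ toℕ)) a
      (product-x n (suc s) (t ∘ suc) (shift s t t-linear) a)

  product-1 : ∀ n s t → LinearFactors s t → productₛ {n} (t ∘ toℕ) 0 0 ≈ 1#
  product-1 zero    s t t-linear = refl
  product-1 (suc n) s t t-linear = trans
    (linear-*-1 s (t 0) (t-linear 0) (productₛ {n} (t ∘ suc ∘ toℕ)))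
    (product-1 n (suc s) (t ∘ suc) (shift s t t-linear))

  -- The gain s in precision makes the induction on n work: the first factor
  -- is split off, and the others are those of (-qˢ⁺¹y;q)ₙ.
  product-y : ∀ n s t → LinearFactors s t → ∀ b →
    productₛ {n} (t ∘ toℕ) 0 b R[q].≈[ n ℕ.+ s ] (𝐪 ^ (s ℕ.* b) * euler b)
  product-y n s t t-linear zero d _ =
    trans (product-1 n s t t-linear) (sym (euler-zero s)) d
  -- The empty product has no positive power of y, and the claimed coefficient is divisible by q to
  -- the power s (b + 1) ≥ s, so both vanish in degrees below s.
  product-y zero s t t-linear (suc b) d d<s =
    R.sym (R[q].X-^-⊛-low (s ℕ.* suc b) (euler (suc b)) d
      (ℕ.<-≤-trans d<s (ℕ.m≤m*n s (suc b))))
  product-y (suc n) s t t-linear (suc b) d d<1+n+s =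
    R.trans (linear-*-y s (t 0) (t-linear 0) E b d) (R.trans
      (R.+-cong (agree (suc b) d d<n+1+s)
                (R[q].⊛-congˡ-≈[] (𝐪 ^ s) (agree b) d d<n+1+s))
      (R.sym (euler-shift s b d)))
    where
    E : ∣S∣
    E = productₛ {n} (t ∘ suc ∘ toℕ)
    agree : ∀ b → E 0 b R[q].≈[ n ℕ.+ suc s ] (𝐪 ^ (suc s ℕ.* b) * euler b)
    agree = product-y n (suc s) (t ∘ suc) (shift s t t-linear)
    -- One factor fewer and s one higher: the precision n + s is the same in the induction
    -- hypothesis.
    d<n+1+s : d < n ℕ.+ suc s
    d<n+1+s = ≡.subst (d <_) (≡.sym (ℕ.+-suc n s)) d<1+n+s

  factors-linear : LinearFactors 0 factor
  factors-linear k = ≡.subst (λ j → LinearFactor j (factor k))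
    (≡.sym (ℕ.+-identityʳ k)) (factor-linear k)

  P-isProduct : Is⟨ - y ⨾ q ⟩∞ P
  -- For s = 0 the product of n factors is already exact in degrees below n, hence at d as soon as n
  -- > d.
  P-isProduct zero b d = suc d , λ n d<n → R.trans
    (product-y n 0 factor factors-linear b d (ℕ.<-≤-trans d<n (ℕ.m≤m+n n 0)))
    (*-identityˡ (euler b) d)
  P-isProduct (suc a) b d = 0 , λ n _ → product-x n 0 factor factors-linear a b d

  -- The triple sum.

  sumₛ-coefficient : ∀ n (t : Fin n → ∣S∣) a b →
    sumₛ t a b ≈ sum (λ i → t i a b)
  sumₛ-coefficient zero    t a b = refl
  sumₛ-coefficient (suc n) t a b = +-congˡ {t Fin.zero a b} (sumₛ-coefficient n (t ∘ Fin.suc) a b)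

  -- The deltas are nested in the order in which they are consumed: the inner one by the sum over
  -- n₃, the outer one by the sums over n₁ and n₂.
  summand-coefficient : ∀ n₁ n₂ n₃ a b → summand n₁ n₂ n₃ a b ≈
    δ (n₁ ℕ.+ n₂) a * (δ n₃ b * coefficient n₁ n₂ n₃)
  summand-coefficient n₁ n₂ n₃ a b = begin
    (ι κ S.* x^m S.* (y ^ₛ n₃)) a b
      ≈⟨ S.*-congˡ {ι κ S.* x^m} (K[y][x].const-^ K⟦y⟧.X n₃) a b ⟩
    (ι κ S.* x^m S.* K⟦x,y⟧.const y^n) a b        ≈⟨ K[y][x].⊛-const (ι κ S.* x^m) y^n a b ⟩
    ((ι κ S.* x^m) a Ky.* y^n) b
      ≈⟨ Ky.*-congʳ {y^n} (K[y][x].constant-⊛ (ι κ) x^m (λ _ → Ky.refl) a) b ⟩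
    (K⟦y⟧.const κ Ky.* x^m a Ky.* y^n) b          ≈⟨ Ky.*-assoc (K⟦y⟧.const κ) (x^m a) y^n b ⟩
    (K⟦y⟧.const κ Ky.* (x^m a Ky.* y^n)) b
      ≈⟨ K[y].constant-⊛ (K⟦y⟧.const κ) (x^m a Ky.* y^n) (λ _ → refl) b ⟩
    κ * (x^m a Ky.* y^n) b
      ≈⟨ *-congˡ {κ} (Ky.*-congʳ {y^n} (K[y][x].X-^ m a) b) ⟩
    κ * (K[y][x].δ m a Ky.* y^n) b
      ≈⟨ *-congˡ {κ} (Ky.*-congʳ {y^n} (δ-const m a) b) ⟩
    κ * (K⟦y⟧.const (δ m a) Ky.* y^n) b
      ≈⟨ *-congˡ {κ} (K[y].constant-⊛ (K⟦y⟧.const (δ m a)) y^n (λ _ → refl) b) ⟩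
    κ * (δ m a * y^n b)                           ≈⟨ *-congˡ {κ} (*-congˡ {δ m a} (K[y].X-^ n₃ b)) ⟩
    κ * (δ m a * δ n₃ b)                          ≈⟨ *-comm κ (δ m a * δ n₃ b) ⟩
    δ m a * δ n₃ b * κ                            ≈⟨ *-assoc (δ m a) (δ n₃ b) κ ⟩
    δ m a * (δ n₃ b * κ)                          ∎
    where
    m : ℕ
    m = n₁ ℕ.+ n₂
    κ : RawRing.Carrier K
    κ = coefficient n₁ n₂ n₃
    x^m : ∣S∣
    x^m = x ^ₛ m
    y^n : ℕ → RawRing.Carrier K
    y^n = K⟦y⟧.X ^ᵧ n₃
    -- Reading off the power of x gives a delta with values in K⟦y⟧; as a constant series it can be
    -- pulled out as a scalar of `K`.
    δ-const : ∀ m a → K[y][x].δ m a Ky.≈ K⟦y⟧.const (δ m a)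
    δ-const zero    zero    = Ky.refl
    δ-const zero    (suc a) zero    = refl
    δ-const zero    (suc a) (suc b) = refl
    δ-const (suc m) zero    zero    = refl
    δ-const (suc m) zero    (suc b) = refl
    δ-const (suc m) (suc a) = δ-const m a

  coefficient-factorisation : ∀ i j n →
    coefficient i j n ≈ prefactor (i ℕ.+ j) n * (u i * r j)
  coefficient-factorisation i j n = trans
    (*-congˡ {numerator i j n}
      (r-product i j n _ (recip-inverse R _ (denominator-0 R i j n))))
    (summand-factorisation i j n)

  -- The product of K⟦y⟧ serves here as the Cauchy product in the auxiliary variable z. There `u`
  -- and `r` are mutually inverse, so only a = 0 survives.
  P-factorisation : ∀ a b → prefactor a b * (u ⊛ᵧ r) a ≈ P a b
  P-factorisation zero    b = trans (*-congˡ {prefactor 0 b} u⊛r-zero)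
    (trans (*-identityʳ (prefactor 0 b)) (prefactor-zero b))
  P-factorisation (suc a) b = trans (*-congˡ {prefactor (suc a) b} (u⊛r-suc a))
    (zeroʳ (prefactor (suc a) b))

  P-isSum : HasSum summand P
  P-isSum a b d = N , vanishing , total d
    where
    N : ℕ
    -- A term can be non-zero only if n₁ + n₂ = a and n₃ = b, so any bound exceeding both a and b
    -- works, whatever d is.
    N = suc (a ℕ.+ b)
    a<N : a < N
    a<N = s≤s (ℕ.m≤m+n a b)
    b<N : b < N
    b<N = s≤s (ℕ.m≤n+m b a)

    x-vanishing : ∀ n₁ n₂ n₃ → a < n₁ ℕ.+ n₂ → summand n₁ n₂ n₃ a b ≈ 0#
    x-vanishing n₁ n₂ n₃ a<n = trans (summand-coefficient n₁ n₂ n₃ a b)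
      (trans (*-congʳ {δ n₃ b * coefficient n₁ n₂ n₃} (δ-above a<n))
             (zeroˡ (δ n₃ b * coefficient n₁ n₂ n₃)))

    y-vanishing : ∀ n₁ n₂ n₃ → b < n₃ → summand n₁ n₂ n₃ a b ≈ 0#
    y-vanishing n₁ n₂ n₃ b<n = trans (summand-coefficient n₁ n₂ n₃ a b)
      (trans (*-congˡ {δ (n₁ ℕ.+ n₂) a} (trans (*-congʳ {κ} (δ-above b<n)) (zeroˡ κ)))
             (zeroʳ (δ (n₁ ℕ.+ n₂) a)))
      where
      κ : RawRing.Carrier K
      κ = coefficient n₁ n₂ n₃

    vanishing : ∀ n₁ n₂ n₃ → N ≤ n₁ ⊎ N ≤ n₂ ⊎ N ≤ n₃ → summand n₁ n₂ n₃ a b d R.≈ R.0#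
    vanishing n₁ n₂ n₃ (inj₁ N≤n₁) =
      x-vanishing n₁ n₂ n₃ (ℕ.<-≤-trans a<N (ℕ.≤-trans N≤n₁ (ℕ.m≤m+n n₁ n₂))) d
    vanishing n₁ n₂ n₃ (inj₂ (inj₁ N≤n₂)) =
      x-vanishing n₁ n₂ n₃ (ℕ.<-≤-trans a<N (ℕ.≤-trans N≤n₂ (ℕ.m≤n+m n₂ n₁))) d
    vanishing n₁ n₂ n₃ (inj₂ (inj₂ N≤n₃)) =
      y-vanishing n₁ n₂ n₃ (ℕ.<-≤-trans b<N N≤n₃) d

    inner : ∀ n₁ n₂ → sumS N (λ n₃ → summand n₁ n₂ n₃) a b ≈
                      δ (n₁ ℕ.+ n₂) a * coefficient n₁ n₂ b
    inner n₁ n₂ = begin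
      sumS N (λ n₃ → summand n₁ n₂ n₃) a b
        ≈⟨ sumₛ-coefficient N (λ k → summand n₁ n₂ (toℕ k)) a b ⟩
      sum {N} (λ k → summand n₁ n₂ (toℕ k) a b)
        ≈⟨ sum-cong-≋ {N} (λ k → summand-coefficient n₁ n₂ (toℕ k) a b) ⟩
      sum {N} (λ k → δ m a * (δ (toℕ k) b * coefficient n₁ n₂ (toℕ k)))
        ≈⟨ *-distribˡ-sum {N} (δ m a) (λ k → δ (toℕ k) b * coefficient n₁ n₂ (toℕ k)) ⟨
      δ m a * sum {N} (λ k → δ (toℕ k) b * coefficient n₁ n₂ (toℕ k))
        ≈⟨ *-congˡ {δ m a} (sum-δ b (coefficient n₁ n₂) b<N) ⟩
      δ m a * coefficient n₁ n₂ b
        ∎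
      where
      m : ℕ
      m = n₁ ℕ.+ n₂

    total : sumS N (λ n₁ → sumS N λ n₂ → sumS N λ n₃ → summand n₁ n₂ n₃) a b ≈ P a b
    total = begin
      sumS N (λ n₁ → sumS N λ n₂ → sumS N λ n₃ → summand n₁ n₂ n₃) a b
        ≈⟨ sumₛ-coefficient N (λ i → sumS N λ n₂ → sumS N λ n₃ → summand (toℕ i) n₂ n₃) a b ⟩
      sum {N} (λ i → sumS N (λ n₂ → sumS N λ n₃ → summand (toℕ i) n₂ n₃) a b)
        ≈⟨ sum-cong-≋ {N} (λ i → trans
             (sumₛ-coefficient N (λ j → sumS N λ n₃ → summand (toℕ i) (toℕ j) n₃) a b)
             (sum-cong-≋ {N} λ j → inner (toℕ i) (toℕ j))) ⟩
      sum {N} (λ i → sum {N} λ j → δ (toℕ i ℕ.+ toℕ j) a * coefficient (toℕ i) (toℕ j) b)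
        -- With n₃ = b fixed, the remaining delta restricts the square to n₁ + n₂ = a, where the
        -- alternating sum `u ⊛ᵧ r` appears.
        ≈⟨ sum-δ-antidiagonal a (λ i j → coefficient i j b) a<N a<N ⟩
      sum {suc a} (λ i → coefficient (toℕ i) (a ∸ toℕ i) b)
        ≈⟨ antidiagonal-sum a b (λ i j → coefficient i j b) (λ i j → coefficient-factorisation i j b) ⟩
      prefactor a b * (u ⊛ᵧ r) a
        ≈⟨ P-factorisation a b ⟩
      P a b
        ∎

theorem1p3 : ∀ {c ℓ} (R : CommutativeRing c ℓ) → let open Identity R in
    ∃ λ P → Is⟨ - y ⨾ q ⟩∞ P × HasSum summand P
theorem1p3 R = P , P-isProduct , P-isSum
  where open Sides R
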